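{- For all $m\geq 2$: $s_{1,m}(211,213)=1$, $s_{2,m}(211,213)=m+1$, and for all $n\geq 3$, \[ s_{n,m}(211,213)=2\,s_{n-1,m}(211,213)+s_{n-2,m}(211,213). \]
   Context: $[n]_m=\{1^m,\ldots,n^m\}$; a permutation of $[n]_m$ is a sequence of length $nm$ in which each element of $[n]$ appears exactly $m$ times. A sequence avoids a pattern $\pi$ if it has no subsequence order-isomorphic to $\pi$ (same relative order and same equalities among entries). $s_{n,m}(\Pi)$ is the number of permutations of $[n]_m$ avoiding all patterns in $\Pi$. -}

module Defs where

open import Data.Fin.Base using (Fin; toℕ)
open import Data.Fin.Properties using (all?) renaming (_≟_ to _≟ᶠ_)
open import Data.List.Base using (List; []; _∷_; [_]; allFin; cartesianProductWith; filter; length)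
import Data.List.Base as List
open import Data.List.Membership.Propositional using (_∈_; lose)
open import Data.List.Membership.Propositional.Properties using (∈-allFin; ∈-cartesianProductWith⁺)
open import Data.List.Relation.Unary.All using (All)
import Data.List.Relation.Unary.All as All
open import Data.List.Relation.Unary.Any using (here; any?; satisfied)
import Data.List.Relation.Unary.AllPairs as AllPairs
open import Data.List.Relation.Unary.Unique.Propositional using (Unique)
open import Data.List.Relation.Unary.Unique.Propositional.Properties using (allFin⁺; cartesianProductWith⁺)
open import Data.List.Relation.Binary.Sublist.Propositional using (_⊆_)
import Data.List.Relation.Binary.Sublist.DecPropositional as DecSublist
open import Data.Nat.Base using (ℕ; zero; suc; _*_; _<_)
open import Data.Nat.Properties using (_<?_; _≟_)
open import Data.Product.Base using (_×_; ∃-syntax; _,_)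
open import Data.Vec.Base using (Vec; []; _∷_; lookup; count; toList)
open import Data.Vec.Properties using (∷-injective)
open import Function.Bundles using (_⇔_; mk⇔; Equivalence)
open import Relation.Binary.PropositionalEquality using (_≡_; refl)
open import Relation.Nullary using (Dec; ¬_; ¬?; _×-dec_; _→-dec_)
open import Relation.Nullary.Decidable using (map′)

-- The letters 1, …, n of [n] are represented, in order, by 0, …, n - 1 in Fin n.
Word : ℕ → ℕ → Set
Word n k = Vec (Fin n) k

IsMultisetPermutation : ∀ {n} m → Word n (n * m) → Set
IsMultisetPermutation m w = ∀ i → count (_≟ᶠ i) w ≡ m

-- Only the relative order and the equalities among the entries of a pattern matter.
Pattern : Set
Pattern = List ℕ

OrderIsomorphic : ∀ {n} (π : Pattern) → Word n (length π) → Set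
OrderIsomorphic π u = ∀ i j →
  ((toℕ (lookup u i) < toℕ (lookup u j)) ⇔ (List.lookup π i < List.lookup π j)) ×
  ((lookup u i ≡ lookup u j) ⇔ (List.lookup π i ≡ List.lookup π j))

-- _⊆_ is the subsequence relation (order-preserving, not necessarily contiguous).
Contains : ∀ {n k} → Word n k → Pattern → Set
Contains {n} w π =
  ∃[ u ] (toList u ⊆ toList w × OrderIsomorphic {n} π u)

Avoids : ∀ {n k} → List Pattern → Word n k → Set
Avoids Π w = All (λ π → ¬ Contains w π) Π

words : ∀ n k → List (Word n k)
words n zero    = [ [] ]
words n (suc k) = cartesianProductWith _∷_ (allFin n) (words n k)

words-complete : ∀ {n k} (w : Word n k) → w ∈ words n k
words-complete []      = here refl
words-complete (x ∷ w) = ∈-cartesianProductWith⁺ _∷_ (∈-allFin x) (words-complete w)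

words-unique : ∀ n k → Unique (words n k)
words-unique n zero    = All.[] AllPairs.∷ AllPairs.[]
words-unique n (suc k) =
  cartesianProductWith⁺ _∷_ ∷-injective (allFin⁺ n) (words-unique n k)

isMultisetPermutation? : ∀ {n} m (w : Word n (n * m)) → Dec (IsMultisetPermutation m w)
isMultisetPermutation? m w = all? (λ i → count (_≟ᶠ i) w ≟ m)

_⇔?_ : ∀ {A B : Set} → Dec A → Dec B → Dec (A ⇔ B)
a? ⇔? b? = map′ (λ (f , g) → mk⇔ f g) (λ e → Equivalence.to e , Equivalence.from e)
  ((a? →-dec b?) ×-dec (b? →-dec a?))

orderIsomorphic? : ∀ {n} π (u : Word n (length π)) → Dec (OrderIsomorphic π u)
orderIsomorphic? π u = all? (λ i → all? (λ j →
  ((toℕ (lookup u i) <? toℕ (lookup u j)) ⇔? (List.lookup π i <? List.lookup π j)) ×-dec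
  ((lookup u i ≟ᶠ lookup u j) ⇔? (List.lookup π i ≟ List.lookup π j))))

contains? : ∀ {n k} (w : Word n k) π → Dec (Contains w π)
contains? {n} w π = map′ satisfied (λ (u , p) → lose (words-complete u) p)
  (any? (λ u → (toList u ⊆? toList w) ×-dec orderIsomorphic? π u) (words n (length π)))
  where open DecSublist _≟ᶠ_ using (_⊆?_)

avoids? : ∀ {n k} Π (w : Word n k) → Dec (Avoids Π w)
avoids? Π w = All.all? (λ π → ¬? (contains? w π)) Π

avoidingPermutations : ∀ n m → List Pattern → List (Word n (n * m))
avoidingPermutations n m Π =
  filter (λ w → isMultisetPermutation? m w ×-dec avoids? Π w) (words n (n * m))

s : ℕ → ℕ → List Pattern → ℕ
s n m Π = length (avoidingPermutations n m Π)

211-213 : List Pattern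
211-213 = (2 ∷ 1 ∷ 1 ∷ []) ∷ (2 ∷ 1 ∷ 3 ∷ []) ∷ []

{-# OPTIONS --safe #-}
module Submission where

open import Defs
open import Data.Nat.Base using (ℕ; _+_; _*_; _∸_; _≤_)
open import Data.Product.Base using (_×_)
open import Relation.Binary.PropositionalEquality using (_≡_)

open import Data.Bool.Base using (true; false)
open import Data.Empty using (⊥)
open import Data.Fin.Base as Fin using (Fin; zero; suc; toℕ)
open import Data.Fin.Properties using (suc-injective; toℕ-injective) renaming (_≟_ to _≟ᶠ_)
open import Data.List.Base
  using (List; []; _∷_; [_]; _++_; map; replicate; length; filter; applyUpTo)
open import Data.List.Membership.Propositional using (_∈_)
open import Data.List.Membership.Propositional.Properties
  using (∈-map⁺; ∈-map⁻; ∈-++⁺ˡ; ∈-++⁺ʳ; ∈-++⁻; ∈-filter⁺; ∈-filter⁻; ∈-applyUpTo⁺; ∈-applyUpTo⁻)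
open import Data.List.Membership.Propositional.Properties.WithK using (unique∧set⇒bag)
open import Data.List.Properties
  using (map-++; ++-assoc; ++-identityʳ; ++-cancelˡ; length-++; length-map; length-replicate;
         map-injective; filter-++; ∷-injectiveˡ; ∷-injectiveʳ; length-applyUpTo)
open import Data.List.Relation.Binary.BagAndSetEquality using (∼bag⇒↭)
open import Data.List.Relation.Binary.Permutation.Propositional.Properties using (↭-length)
open import Data.List.Relation.Binary.Sublist.Propositional
  using (_⊆_; []; _∷_; _∷ʳ_; ⊆-refl; ⊆-trans; minimum; from∈; to∈)
open import Data.List.Relation.Binary.Sublist.Propositional.Properties using (++⁺; ++⁺ˡ; ++⁺ʳ)
  renaming (map⁺ to ⊆-map⁺)
open import Data.List.Relation.Unary.All as All using ([]; _∷_)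
open import Data.List.Relation.Unary.AllPairs using ([]; _∷_)
open import Data.List.Relation.Unary.Any using (here; there)
open import Data.List.Relation.Unary.Unique.Propositional using (Unique)
import Data.List.Relation.Unary.Unique.Propositional.Properties as Unique
open import Data.Nat.Base using (zero; suc; _<_; s≤s; z≤n; s≤s⁻¹)
open import Data.Nat.Properties
  using (≤⇒≯; ≮⇒≥; <-trans; <-irrefl; <-asym; n≤0⇒n≡0; m≤m+n; m+n∸m≡n; m+[n∸m]≡n;
         +-comm; +-assoc; +-suc; +-identityʳ; +-cancelˡ-≡)
  renaming (suc-injective to ℕ-suc-injective)
open import Data.Product.Base using (∃-syntax; ∃₂; _,_; proj₁; proj₂)
open import Data.Sum.Base using (_⊎_; inj₁; inj₂)
open import Data.Vec.Base using (Vec; []; _∷_; toList; fromList; count)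
open import Data.Vec.Properties using (toList∘fromList; toList-injective; cast-is-id; length-toList)
open import Function.Base using (_∘_)
open import Function.Bundles using (_⇔_; mk⇔; Equivalence)
open import Level using (0ℓ)
open import Relation.Binary.PropositionalEquality
  using (refl; sym; trans; cong; cong₂; subst; _≢_; module ≡-Reasoning)
open import Relation.Nullary using (¬_; does; contradiction)
open import Relation.Unary using (Pred; Decidable)

-- In an avoiding word at most one smallest letter 1 can follow the first larger letter, so the
-- word is 1^m u, or 1^(m-1) u 1 v with u nonempty, where u v is an avoiding word on the larger
-- letters. In the second case avoiding 213 means that no letter of v exceeds a letter of u. If
-- there are at least two larger letters, 2 being the least, this forces v to be empty or the
-- single letter 2 (as m ≥ 2), and u 2 is avoiding exactly when u = 2^(m-1) t with t avoiding.
-- The three cases contribute s_{n-1}, s_{n-1} and s_{n-2}.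

private
  variable
    n m k : ℕ

-- Good words as lists

occ : Fin n → List (Fin n) → ℕ
occ i w = length (filter (_≟ᶠ i) w)

-- The two patterns at once: b a c matches 211 when c ≡ a < b, and 213 when a < b < c.
Av : List (Fin n) → Set
Av w = ∀ {a b c} → a Fin.< b → c ≡ a ⊎ b Fin.< c → ¬ (b ∷ a ∷ c ∷ [] ⊆ w)

-- Lists replace vectors of length `n * m`, so that words can be cut and joined freely; `size` keeps
-- the length that the type no longer records.
record Good (m n : ℕ) (w : List (Fin n)) : Set where
  constructor good
  field
    size   : length w ≡ n * m
    counts : ∀ i → occ i w ≡ m
    avoids : Av w

open Good

-- Vectors and lists

count-toList : (i : Fin n) (w : Vec (Fin n) k) → count (_≟ᶠ i) w ≡ occ i (toList w)
count-toList i []      = refl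
count-toList i (x ∷ w) with does (x ≟ᶠ i)
... | true  = cong suc (count-toList i w)
... | false = count-toList i w

⇔-true : {P Q : Set} → P → Q → P ⇔ Q
⇔-true p q = mk⇔ (λ _ → q) (λ _ → p)

⇔-false : {P Q : Set} → ¬ P → ¬ Q → P ⇔ Q
⇔-false ¬p ¬q = mk⇔ (λ p → contradiction p ¬p) (λ q → contradiction q ¬q)

-- This is the condition of `OrderIsomorphic` at a single pair of positions.
SameOrder : Fin n → Fin n → ℕ → ℕ → Set
SameOrder x y p q = (toℕ x < toℕ y ⇔ p < q) × (x ≡ y ⇔ p ≡ q)

same-< : {x y : Fin n} {p q : ℕ} → x Fin.< y → p < q → SameOrder x y p q
same-< x<y p<q =
  ⇔-true x<y p<q , ⇔-false (λ { refl → <-irrefl refl x<y }) (λ { refl → <-irrefl refl p<q })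

same-> : {x y : Fin n} {p q : ℕ} → y Fin.< x → q < p → SameOrder x y p q
same-> y<x q<p =
  ⇔-false (<-asym y<x) (<-asym q<p) ,
  ⇔-false (λ { refl → <-irrefl refl y<x }) (λ { refl → <-irrefl refl q<p })

same-≡ : {x y : Fin n} {p q : ℕ} → x ≡ y → p ≡ q → SameOrder x y p q
same-≡ refl refl = ⇔-false (<-irrefl refl) (<-irrefl refl) , ⇔-true refl refl

211-isomorphic : {a b : Fin n} → a Fin.< b → OrderIsomorphic (2 ∷ 1 ∷ 1 ∷ []) (b ∷ a ∷ a ∷ [])
211-isomorphic a<b zero             zero             = same-≡ refl refl
211-isomorphic a<b zero             (suc zero)       = same-> a<b (s≤s (s≤s z≤n))
211-isomorphic a<b zero             (suc (suc zero)) = same-> a<b (s≤s (s≤s z≤n))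
211-isomorphic a<b (suc zero)       zero             = same-< a<b (s≤s (s≤s z≤n))
211-isomorphic a<b (suc zero)       (suc zero)       = same-≡ refl refl
211-isomorphic a<b (suc zero)       (suc (suc zero)) = same-≡ refl refl
211-isomorphic a<b (suc (suc zero)) zero             = same-< a<b (s≤s (s≤s z≤n))
211-isomorphic a<b (suc (suc zero)) (suc zero)       = same-≡ refl refl
211-isomorphic a<b (suc (suc zero)) (suc (suc zero)) = same-≡ refl refl

213-isomorphic : {a b c : Fin n} → a Fin.< b → b Fin.< c →
                 OrderIsomorphic (2 ∷ 1 ∷ 3 ∷ []) (b ∷ a ∷ c ∷ [])
213-isomorphic a<b b<c zero             zero             = same-≡ refl refl
213-isomorphic a<b b<c zero             (suc zero)       = same-> a<b (s≤s (s≤s z≤n))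
213-isomorphic a<b b<c zero             (suc (suc zero)) = same-< b<c (s≤s (s≤s (s≤s z≤n)))
213-isomorphic a<b b<c (suc zero)       zero             = same-< a<b (s≤s (s≤s z≤n))
213-isomorphic a<b b<c (suc zero)       (suc zero)       = same-≡ refl refl
213-isomorphic a<b b<c (suc zero)       (suc (suc zero)) = same-< (<-trans a<b b<c) (s≤s (s≤s z≤n))
213-isomorphic a<b b<c (suc (suc zero)) zero             = same-> b<c (s≤s (s≤s (s≤s z≤n)))
213-isomorphic a<b b<c (suc (suc zero)) (suc zero)       = same-> (<-trans a<b b<c) (s≤s (s≤s z≤n))
213-isomorphic a<b b<c (suc (suc zero)) (suc (suc zero)) = same-≡ refl refl

Avoids⇒Av : (w : Vec (Fin n) k) → Avoids 211-213 w → Av (toList w)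
Avoids⇒Av w (¬211 ∷ _ ∷ []) a<b (inj₁ refl) p = ¬211 (_ ∷ _ ∷ _ ∷ [] , p , 211-isomorphic a<b)
Avoids⇒Av w (_ ∷ ¬213 ∷ []) a<b (inj₂ b<c)  p = ¬213 (_ ∷ _ ∷ _ ∷ [] , p , 213-isomorphic a<b b<c)

Av⇒Avoids : (w : Vec (Fin n) k) → Av (toList w) → Avoids 211-213 w
Av⇒Avoids w av = ¬211 ∷ ¬213 ∷ []
  where
  ¬211 : ¬ Contains w (2 ∷ 1 ∷ 1 ∷ [])
  ¬211 (b ∷ a ∷ c ∷ [] , p , iso) =
    av (Equivalence.from (proj₁ (iso (suc zero) zero)) (s≤s (s≤s z≤n)))
       (inj₁ (Equivalence.from (proj₂ (iso (suc (suc zero)) (suc zero))) refl)) p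
  ¬213 : ¬ Contains w (2 ∷ 1 ∷ 3 ∷ [])
  ¬213 (b ∷ a ∷ c ∷ [] , p , iso) =
    av (Equivalence.from (proj₁ (iso (suc zero) zero)) (s≤s (s≤s z≤n)))
       (inj₂ (Equivalence.from (proj₁ (iso zero (suc (suc zero)))) (s≤s (s≤s (s≤s z≤n))))) p

toList-surjective : {A : Set} (xs : List A) → length xs ≡ n → ∃[ v ] toList {n = n} v ≡ xs
toList-surjective xs refl = fromList xs , toList∘fromList xs

-- Counting by duplicate-free enumerations

record Enumeration (m n c : ℕ) : Set where
  field
    list     : List (List (Fin n))
    unique   : Unique list
    sound    : ∀ {w} → w ∈ list → Good m n w
    complete : ∀ {w} → Good m n w → w ∈ list
    total    : length list ≡ c

-- Two duplicate-free lists with the same members are permutations of each other. Thus the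
-- brute-force list behind `s` can be compared with a list built by hand.
Enumeration-unique : ∀ {c d} → Enumeration m n c → Enumeration m n d → c ≡ d
Enumeration-unique E F = trans (sym E.total) (trans
  (↭-length (∼bag⇒↭ (unique∧set⇒bag E.unique F.unique
    (mk⇔ (F.complete ∘ E.sound) (E.complete ∘ F.sound)))))
  F.total)
  where
  module E = Enumeration E
  module F = Enumeration F

-- At a fixed length `toList` is injective, so no duplicates arise, and `size` shows that every good
-- list comes from a vector of that length.
filter-Enumeration : {P : Pred (Word n (n * m)) 0ℓ} (P? : Decidable P) {vs : List (Word n (n * m))} →
                     Unique vs → (∀ v → v ∈ vs) →
                     (∀ v → P v → Good m n (toList v)) → (∀ v → Good m n (toList v) → P v) →
                     Enumeration m n (length (filter P? vs))
filter-Enumeration {n} {m} P? {vs} vs-unique all∈vs P⇒Good Good⇒P = record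
  { list     = map toList (filter P? vs)
  ; unique   = Unique.map⁺ injective (Unique.filter⁺ P? vs-unique)
  ; sound    = λ w∈ → let v , v∈ , w≡ = ∈-map⁻ toList w∈ in
      subst (Good m n) (sym w≡) (P⇒Good v (proj₂ (∈-filter⁻ P? {xs = vs} v∈)))
  ; complete = λ {w} g → let v , v≡ = toList-surjective w (size g) in
      subst (_∈ map toList (filter P? vs)) v≡
        (∈-map⁺ toList (∈-filter⁺ P? (all∈vs v) (Good⇒P v (subst (Good m n) (sym v≡) g))))
  ; total    = length-map toList (filter P? vs)
  }
  where
  injective : ∀ {l} {v v′ : Vec (Fin n) l} → toList v ≡ toList v′ → v ≡ v′
  injective {v = v} {v′} eq = trans (sym (cast-is-id refl v)) (toList-injective refl v v′ eq)

s-Enumeration : ∀ m n → Enumeration m n (s n m 211-213)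
s-Enumeration m n = filter-Enumeration _ (words-unique n (n * m)) words-complete
  (λ v (mult , av) → good (length-toList v) (λ i → trans (sym (count-toList i v)) (mult i)) (Avoids⇒Av v av))
  (λ v g → (λ i → trans (count-toList i v) (counts g i)) , Av⇒Avoids v (avoids g))

-- Words by the position of their smallest letter

-- The word 1^k u: `map suc` shifts the letters of `u` up, and `zero` becomes the new smallest
-- letter.
gathered : ℕ → List (Fin n) → List (Fin (suc n))
gathered k u = replicate k zero ++ map suc u

-- The word 1^k u 1 v. With the isolated `zero` it has k + 1 smallest letters, so multiplicity
-- `suc k` goes with `scattered k`.
scattered : ℕ → List (Fin n) → List (Fin n) → List (Fin (suc n))
scattered k u v = replicate k zero ++ map suc u ++ zero ∷ map suc v

_≼_ : List (Fin n) → List (Fin n) → Set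
v ≼ u = ∀ {x y} → x ∈ v → y ∈ u → x Fin.≤ y

-- Letter counts and lengths

occ-++ : ∀ (i : Fin n) u v → occ i (u ++ v) ≡ occ i u + occ i v
occ-++ i u v = trans (cong length (filter-++ (_≟ᶠ i) u v)) (length-++ (filter (_≟ᶠ i) u))

occ-zero-map-suc : (u : List (Fin n)) → occ zero (map suc u) ≡ 0
occ-zero-map-suc []      = refl
occ-zero-map-suc (_ ∷ u) = occ-zero-map-suc u

occ-suc-map-suc : ∀ (i : Fin n) u → occ (suc i) (map suc u) ≡ occ i u
occ-suc-map-suc i []      = refl
occ-suc-map-suc i (x ∷ u) with does (x ≟ᶠ i)
... | true  = cong suc (occ-suc-map-suc i u)
... | false = occ-suc-map-suc i u

occ-zero-zeros : ∀ k (w : List (Fin (suc n))) → occ zero (replicate k zero ++ w) ≡ k + occ zero w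
occ-zero-zeros zero    w = refl
occ-zero-zeros (suc k) w = cong suc (occ-zero-zeros k w)

occ-suc-zeros : ∀ (i : Fin n) k w → occ (suc i) (replicate k zero ++ w) ≡ occ (suc i) w
occ-suc-zeros i zero    w = refl
occ-suc-zeros i (suc k) w = occ-suc-zeros i k w

occ-zero-gathered : ∀ k (u : List (Fin n)) → occ zero (gathered k u) ≡ k
occ-zero-gathered k u =
  trans (occ-zero-zeros k (map suc u)) (trans (cong (k +_) (occ-zero-map-suc u)) (+-identityʳ k))

occ-suc-gathered : ∀ (i : Fin n) k u → occ (suc i) (gathered k u) ≡ occ i u
occ-suc-gathered i k u = trans (occ-suc-zeros i k (map suc u)) (occ-suc-map-suc i u)

occ-zero-scattered : ∀ k (u v : List (Fin n)) → occ zero (scattered k u v) ≡ suc k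
occ-zero-scattered k u v = begin
  occ zero (scattered k u v)                                  ≡⟨ occ-zero-zeros k _ ⟩
  k + occ zero (map suc u ++ zero ∷ map suc v)                ≡⟨ cong (k +_) (occ-++ zero (map suc u) _) ⟩
  k + (occ zero (map suc u) + suc (occ zero (map suc v)))     ≡⟨ cong₂ (λ p q → k + (p + suc q))
                                                                   (occ-zero-map-suc u) (occ-zero-map-suc v) ⟩
  k + 1                                                       ≡⟨ +-comm k 1 ⟩
  suc k                                                       ∎
  where open ≡-Reasoning

occ-suc-scattered : ∀ (i : Fin n) k u v → occ (suc i) (scattered k u v) ≡ occ i (u ++ v)
occ-suc-scattered i k u v = begin
  occ (suc i) (scattered k u v)                     ≡⟨ occ-suc-zeros i k _ ⟩
  occ (suc i) (map suc u ++ zero ∷ map suc v)       ≡⟨ occ-++ (suc i) (map suc u) _ ⟩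
  occ (suc i) (map suc u) + occ (suc i) (map suc v) ≡⟨ cong₂ _+_ (occ-suc-map-suc i u) (occ-suc-map-suc i v) ⟩
  occ i u + occ i v                                 ≡⟨ sym (occ-++ i u v) ⟩
  occ i (u ++ v)                                    ∎
  where open ≡-Reasoning

length-gathered : ∀ k (u : List (Fin n)) → length (gathered k u) ≡ k + length u
length-gathered k u =
  trans (length-++ (replicate k zero)) (cong₂ _+_ (length-replicate k) (length-map suc u))

length-scattered : ∀ k (u v : List (Fin n)) → length (scattered k u v) ≡ suc k + length (u ++ v)
length-scattered k u v = begin
  length (scattered k u v)                        ≡⟨ length-++ (replicate k zero) ⟩
  length (replicate k zero) + length (map suc u ++ zero ∷ map suc v)
    ≡⟨ cong₂ _+_ (length-replicate k) (length-++ (map suc u)) ⟩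
  k + (length (map suc u) + suc (length (map suc v)))
    ≡⟨ cong₂ (λ p q → k + (p + suc q)) (length-map suc u) (length-map suc v) ⟩
  k + (length u + suc (length v))                 ≡⟨ cong (k +_) (+-suc (length u) (length v)) ⟩
  k + suc (length u + length v)                   ≡⟨ +-suc k _ ⟩
  suc k + (length u + length v)                   ≡⟨ cong (suc k +_) (sym (length-++ u)) ⟩
  suc k + length (u ++ v)                         ∎
  where open ≡-Reasoning

-- Avoidance in gathered and scattered words

Av-⊆ : {u w : List (Fin n)} → u ⊆ w → Av w → Av u
Av-⊆ u⊆w av a<b bad p = av a<b bad (⊆-trans p u⊆w)

Av-map-suc⁻ : {w : List (Fin n)} → Av (map suc w) → Av w
Av-map-suc⁻ av a<b (inj₁ refl) p = av (s≤s a<b) (inj₁ refl) (⊆-map⁺ suc p)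
Av-map-suc⁻ av a<b (inj₂ b<c)  p = av (s≤s a<b) (inj₂ (s≤s b<c)) (⊆-map⁺ suc p)

⊆-map⁻ : {A B : Set} (f : A → B) {ys : List B} (xs : List A) → ys ⊆ map f xs →
         ∃[ zs ] ys ≡ map f zs × zs ⊆ xs
⊆-map⁻ f []       []         = [] , refl , []
⊆-map⁻ f (x ∷ xs) (_ ∷ʳ p)   with ⊆-map⁻ f xs p
... | zs , refl , q = zs , refl , x ∷ʳ q
⊆-map⁻ f (x ∷ xs) (refl ∷ p) with ⊆-map⁻ f xs p
... | zs , refl , q = x ∷ zs , refl , refl ∷ q

Av-map-suc⁺ : {w : List (Fin n)} → Av w → Av (map suc w)
Av-map-suc⁺ {w = w} av a<b bad p with ⊆-map⁻ suc w p
Av-map-suc⁺ av a<b (inj₁ refl) p | a ∷ b ∷ c ∷ [] , refl , q = av (s≤s⁻¹ a<b) (inj₁ refl) q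
Av-map-suc⁺ av a<b (inj₂ b<c)  p | a ∷ b ∷ c ∷ [] , refl , q = av (s≤s⁻¹ a<b) (inj₂ (s≤s⁻¹ b<c)) q

-- The first entry of 211 and of 213 exceeds the second, so a leading `zero` cannot start an
-- occurrence.
Av-zeros⁺ : ∀ k {w : List (Fin (suc n))} → Av w → Av (replicate k zero ++ w)
Av-zeros⁺ zero    av               = av
Av-zeros⁺ (suc k) av a<b bad (_ ∷ʳ p) = Av-zeros⁺ k av a<b bad p
Av-zeros⁺ (suc k) av () bad (refl ∷ p)

-- Used to sort the occurrences of a pattern in a scattered word by which entry, if any, is the
-- isolated `zero`.
⊆-insert⁻ : {A : Set} {zs : List A} (xs : List A) {y : A} {ys : List A} → zs ⊆ xs ++ y ∷ ys →
            zs ⊆ xs ++ ys ⊎ ∃₂ λ zs₁ zs₂ → zs ≡ zs₁ ++ y ∷ zs₂ × zs₁ ⊆ xs × zs₂ ⊆ ys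
⊆-insert⁻ []       (_ ∷ʳ p)   = inj₁ p
⊆-insert⁻ []       (refl ∷ p) = inj₂ ([] , _ , refl , [] , p)
⊆-insert⁻ (x ∷ xs) (_ ∷ʳ p)   with ⊆-insert⁻ xs p
... | inj₁ q                         = inj₁ (x ∷ʳ q)
... | inj₂ (zs₁ , zs₂ , eq , q , r)  = inj₂ (zs₁ , zs₂ , eq , x ∷ʳ q , r)
⊆-insert⁻ (x ∷ xs) (refl ∷ p) with ⊆-insert⁻ xs p
... | inj₁ q                           = inj₁ (refl ∷ q)
... | inj₂ (zs₁ , zs₂ , refl , q , r)  = inj₂ (x ∷ zs₁ , zs₂ , refl , refl ∷ q , r)

Av-gathered⁺ : ∀ k {u : List (Fin n)} → Av u → Av (gathered k u)
Av-gathered⁺ k av = Av-zeros⁺ k (Av-map-suc⁺ av)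

Av-gathered⁻ : ∀ k {u : List (Fin n)} → Av (gathered k u) → Av u
Av-gathered⁻ k = Av-map-suc⁻ ∘ Av-⊆ (++⁺ˡ (replicate k zero) ⊆-refl)

Av-scattered⁺ : ∀ k (u v : List (Fin n)) → v ≼ u → Av (u ++ v) → Av (scattered k u v)
Av-scattered⁺ k u v v≼u av = Av-zeros⁺ k tail
  where
  tail : Av (map suc u ++ zero ∷ map suc v)
  tail a<b bad p with ⊆-insert⁻ (map suc u) p
  tail a<b bad p | inj₁ q = Av-map-suc⁺ av a<b bad (subst (_ ⊆_) (sym (map-++ suc u v)) q)
  -- The isolated `zero` as first entry: it would have to exceed the second.
  tail () bad p | inj₂ ([] , _ , refl , q , r)
  -- As middle entry: 211 needs another `zero` in `map suc v`, and 213 needs a letter of `v` above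
  -- one of `u`.
  tail a<b (inj₁ refl) p | inj₂ (_ ∷ [] , _ , refl , q , r) with ⊆-map⁻ suc v r
  ... | [] , () , _
  ... | _ ∷ _ , () , _
  tail a<b (inj₂ b<c) p | inj₂ (_ ∷ [] , _ , refl , q , r) with ⊆-map⁻ suc u q | ⊆-map⁻ suc v r
  ... | y ∷ [] , refl , q′ | x ∷ [] , refl , r′ =
    contradiction (s≤s⁻¹ b<c) (≤⇒≯ (v≼u (to∈ r′) (to∈ q′)))
  -- As last entry: 211 needs a `zero` in `map suc u`, and 213 needs a letter below `zero`.
  tail a<b (inj₁ refl) p | inj₂ (_ ∷ _ ∷ [] , _ , refl , q , r) with ⊆-map⁻ suc u q
  ... | _ ∷ [] , () , _
  ... | _ ∷ _ ∷ _ , () , _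
  tail a<b (inj₂ ()) p | inj₂ (_ ∷ _ ∷ [] , _ , refl , q , r)
  tail a<b bad p | inj₂ (_ ∷ _ ∷ _ ∷ [] , _ , () , q , r)
  tail a<b bad p | inj₂ (_ ∷ _ ∷ _ ∷ _ ∷ _ , _ , () , q , r)

-- Letters y of `u` and x of `v` with y < x would form a 213 around the isolated `zero`; deleting
-- all the zeros leaves `u ++ v`, shifted.
Av-scattered⁻ : ∀ k (u v : List (Fin n)) → Av (scattered k u v) → v ≼ u × Av (u ++ v)
Av-scattered⁻ k u v av = v≼u , Av-map-suc⁻ (Av-⊆ skip av)
  where
  skip : map suc (u ++ v) ⊆ scattered k u v
  skip = subst (_⊆ scattered k u v) (sym (map-++ suc u v))
    (++⁺ˡ (replicate k zero) (++⁺ ⊆-refl (zero ∷ʳ ⊆-refl)))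
  v≼u : v ≼ u
  v≼u x∈v y∈u = ≮⇒≥ λ y<x → av (s≤s z≤n) (inj₂ (s≤s y<x))
    (++⁺ˡ (replicate k zero) (++⁺ (from∈ (∈-map⁺ suc y∈u)) (refl ∷ from∈ (∈-map⁺ suc x∈v))))

-- Adding and removing the smallest letter in good words

Good-gathered⁺ : ∀ {u} → Good m n u → Good m (suc n) (gathered m u)
Good-gathered⁺ {m} {n} {u} g = good
  (trans (length-gathered m u) (cong (m +_) (size g)))
  (λ { zero    → occ-zero-gathered m u
     ; (suc i) → trans (occ-suc-gathered i m u) (counts g i) })
  (Av-gathered⁺ m (avoids g))

Good-gathered⁻ : ∀ {u} → Good m (suc n) (gathered m u) → Good m n u
Good-gathered⁻ {m} {n} {u} g = good
  (+-cancelˡ-≡ m _ _ (trans (sym (length-gathered m u)) (size g)))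
  (λ i → trans (sym (occ-suc-gathered i m u)) (counts g (suc i)))
  (Av-gathered⁻ m (avoids g))

Good-scattered⁺ : ∀ u v → v ≼ u → Good (suc k) n (u ++ v) → Good (suc k) (suc n) (scattered k u v)
Good-scattered⁺ {k} u v v≼u g = good
  (trans (length-scattered k u v) (cong (suc k +_) (size g)))
  (λ { zero    → occ-zero-scattered k u v
     ; (suc i) → trans (occ-suc-scattered i k u v) (counts g i) })
  (Av-scattered⁺ k u v v≼u (avoids g))

Good-scattered⁻ : ∀ u v → Good (suc k) (suc n) (scattered k u v) → v ≼ u × Good (suc k) n (u ++ v)
Good-scattered⁻ {k} u v g with Av-scattered⁻ k u v (avoids g)
... | v≼u , av = v≼u , good
  (+-cancelˡ-≡ (suc k) _ _ (trans (sym (length-scattered k u v)) (size g)))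
  (λ i → trans (sym (occ-suc-scattered i k u v)) (counts g (suc i)))
  av

-- Decomposition of an avoiding word

data Zeros {n} : List (Fin (suc n)) → Set where
  none : ∀ u → Zeros (map suc u)
  one  : ∀ u v → Zeros (map suc u ++ zero ∷ map suc v)
  two  : ∀ {w} → zero ∷ zero ∷ [] ⊆ w → Zeros w

zeros : (w : List (Fin (suc n))) → Zeros w
zeros []          = none []
zeros (suc x ∷ w) with zeros w
... | none u  = none (x ∷ u)
... | one u v = one (x ∷ u) v
... | two p   = two (_ ∷ʳ p)
zeros (zero ∷ w)  with zeros w
... | none u  = one [] u
... | one u v = two (refl ∷ ++⁺ˡ (map suc u) (refl ∷ minimum _))
... | two p   = two (_ ∷ʳ p)

-- The block before the isolated `zero` is kept nonempty because `scattered k [] v` is the same word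
-- as `gathered (suc k) v`.
data Shape {n} : List (Fin (suc n)) → Set where
  is-gathered  : ∀ k u → Shape (gathered k u)
  is-scattered : ∀ k x u v → Shape (scattered k (x ∷ u) v)

-- Leading zeros are peeled off up to the first larger letter. Two zeros behind that letter would
-- form a 211, so `Zeros` need not distinguish beyond two.
shape : (w : List (Fin (suc n))) → Av w → Shape w
shape []          av = is-gathered 0 []
shape (zero ∷ w)  av with shape w (Av-⊆ (zero ∷ʳ ⊆-refl) av)
... | is-gathered k u      = is-gathered (suc k) u
... | is-scattered k x u v = is-scattered (suc k) x u v
shape (suc x ∷ w) av with zeros w
... | none u  = is-gathered 0 (x ∷ u)
... | one u v = is-scattered 0 x u v
... | two p   = contradiction (refl ∷ p) (av (s≤s z≤n) (inj₁ refl))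

data GoodShape (k n : ℕ) : List (Fin (suc n)) → Set where
  is-gathered  : ∀ u → Good (suc k) n u → GoodShape k n (gathered (suc k) u)
  is-scattered : ∀ x u v → v ≼ (x ∷ u) → Good (suc k) n (x ∷ u ++ v) →
                 GoodShape k n (scattered k (x ∷ u) v)

-- The multiplicity of `zero` fixes the number `l` of leading zeros: `suc k` in the gathered case,
-- `k` in the scattered one.
goodShape : ∀ {w} → Good (suc k) (suc n) w → GoodShape k n w
goodShape {w = w} g with shape w (avoids g)
... | is-gathered l u with refl ← trans (sym (occ-zero-gathered l u)) (counts g zero) =
  is-gathered u (Good-gathered⁻ g)
... | is-scattered l x u v with refl ← trans (sym (occ-zero-scattered l (x ∷ u) v)) (counts g zero) =
  is-scattered x u v (proj₁ (Good-scattered⁻ (x ∷ u) v g)) (proj₂ (Good-scattered⁻ (x ∷ u) v g))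

-- Distinctness of the constructed words

gathered-injective : ∀ k {u v : List (Fin n)} → gathered k u ≡ gathered k v → u ≡ v
gathered-injective k = map-injective suc-injective ∘ ++-cancelˡ (replicate k zero) _ _

-- Past the k leading zeros, the next `zero` marks where `u` ends and `v` begins.
scattered-injective : ∀ k (u u′ : List (Fin n)) {v v′} → scattered k u v ≡ scattered k u′ v′ →
                      u ≡ u′ × v ≡ v′
scattered-injective (suc k) u       u′       eq = scattered-injective k u u′ (∷-injectiveʳ eq)
scattered-injective zero    []      []       eq = refl , map-injective suc-injective (∷-injectiveʳ eq)
scattered-injective zero    (x ∷ u) (y ∷ u′) eq
  with refl , refl ← scattered-injective zero u u′ (∷-injectiveʳ eq) =
  cong (_∷ u) (suc-injective (∷-injectiveˡ eq)) , refl

-- After k common zeros one word continues with `zero`, the other with `suc x`.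
gathered≢scattered : ∀ k {u : List (Fin n)} x v v′ → gathered (suc k) u ≢ scattered k (x ∷ v) v′
gathered≢scattered (suc k) x v v′ eq = gathered≢scattered k x v v′ (∷-injectiveʳ eq)

-- One and two letters

Fin1-word : (w : List (Fin 1)) → w ≡ replicate (length w) zero
Fin1-word []         = refl
Fin1-word (zero ∷ w) = cong (zero ∷_) (Fin1-word w)

-- With a single letter there is no a < b, so avoidance is vacuous, and the multiplicity is the
-- length.
Good-Fin1 : (w : List (Fin 1)) → length w ≡ m → Good m 1 w
Good-Fin1 {m} w eq = good (trans eq (sym (+-identityʳ m))) (λ { zero → trans (occ-zero w) eq })
  (λ { {zero} {zero} () })
  where
  occ-zero : ∀ w → occ zero w ≡ length w
  occ-zero []         = refl
  occ-zero (zero ∷ w) = cong suc (occ-zero w)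

Good-Fin1-length : ∀ {w} → Good m 1 w → length w ≡ m
Good-Fin1-length {m} g = trans (size g) (+-identityʳ m)

Enumeration-one : ∀ m → Enumeration m 1 1
Enumeration-one m = record
  { list     = [ replicate m zero ]
  ; unique   = [] ∷ []
  ; sound    = λ { (here refl) → Good-Fin1 _ (length-replicate m) }
  ; complete = λ {w} g → here (trans (Fin1-word w) (cong (λ l → replicate l zero) (Good-Fin1-length g)))
  ; total    = refl
  }

-- Here u v is 2^(k+1). Besides 1^(k+1) 2^(k+1) there is one word for each nonempty u = 2^(j+1) with
-- j from 0 to k, and v = 2^(k-j); `v ≼ u` is automatic.
Enumeration-two : ∀ k → Enumeration (suc k) 2 (suc k + 1)
Enumeration-two k = record
  { list     = list
  ; unique   = unique
  ; sound    = sound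
  ; complete = complete
  ; total    = trans (cong suc (length-applyUpTo family (suc k))) (+-comm 1 (suc k))
  }
  where
  family : ℕ → List (Fin 2)
  family j = scattered k (replicate (suc j) zero) (replicate (k ∸ j) zero)

  list : List (List (Fin 2))
  list = gathered (suc k) (replicate (suc k) zero) ∷ applyUpTo family (suc k)

  unique : Unique list
  unique = All.tabulate (λ x∈ eq → let j , _ , eq′ = ∈-applyUpTo⁻ family x∈ in
      gathered≢scattered k zero (replicate j zero) _ (trans eq eq′))
    -- Equal words have equal blocks before the isolated `zero`; comparing their lengths gives i =
    -- j, against i < j.
    ∷ Unique.applyUpTo⁺₁ family (suc k) (λ {i} {j} i<j _ eq → <-irrefl
        (trans (sym (length-replicate i)) (trans (cong length (∷-injectiveʳ (proj₁
          (scattered-injective k (replicate (suc i) zero) (replicate (suc j) zero) eq))))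
          (length-replicate j)))
        i<j)

  complete : ∀ {w} → Good (suc k) 2 w → w ∈ list
  complete g with goodShape g
  ... | is-gathered u g′ = here (cong (gathered (suc k))
    (trans (Fin1-word u) (cong (λ l → replicate l zero) (Good-Fin1-length g′))))
  -- The index in `family` is the number of letters of the first block after its head, at most k by
  -- `lengths`.
  ... | is-scattered zero u v _ g′ = there (subst (_∈ applyUpTo family (suc k)) (sym eq)
      (∈-applyUpTo⁺ family (s≤s (subst (length u ≤_) lengths (m≤m+n (length u) (length v))))))
    where
    lengths : length u + length v ≡ k
    lengths = trans (sym (length-++ u)) (ℕ-suc-injective (Good-Fin1-length g′))
    eq : scattered k (zero ∷ u) v ≡ family (length u)
    eq = cong₂ (λ u v → scattered k (zero ∷ u) v) (Fin1-word u) (trans (Fin1-word v)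
      (cong (λ l → replicate l zero)
        (trans (sym (m+n∸m≡n (length u) (length v))) (cong (_∸ length u) lengths))))

  sound : ∀ {w} → w ∈ list → Good (suc k) 2 w
  sound (here refl) = Good-gathered⁺ (Good-Fin1 _ (length-replicate (suc k)))
  sound (there w∈) with ∈-applyUpTo⁻ family w∈
  ... | j , j<1+k , refl = Good-scattered⁺ (replicate (suc j) zero) _ (λ { {zero} _ _ → z≤n })
    (Good-Fin1 _ (cong suc (trans (length-++ (replicate j zero))
      (trans (cong₂ _+_ (length-replicate j) (length-replicate (k ∸ j))) (m+[n∸m]≡n (s≤s⁻¹ j<1+k))))))

-- The recurrence

Good-nonempty : Good (suc k) (suc n) [] → ⊥
Good-nonempty g with () ← counts g zero

-- Multiplicity at least 2 enters here: even a scattered word then has at least one leading `zero`.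
head-zero : ∀ {x w} → Good (suc (suc k)) (suc n) (x ∷ w) → x ≡ zero
head-zero {k} {n} {x} {w} g = go (goodShape g) refl
  where
  go : ∀ {w′} → GoodShape (suc k) n w′ → x ∷ w ≡ w′ → x ≡ zero
  go (is-gathered _ _)          refl = refl
  go (is-scattered _ _ _ _ _)   refl = refl

zero-word : (w : List (Fin (suc n))) → (∀ {x} → x ∈ w → x ≡ zero) → w ≡ replicate (length w) zero
zero-word []      _   = refl
zero-word (x ∷ w) all = cong₂ _∷_ (all (here refl)) (zero-word w (all ∘ there))

-- At most one `zero` may follow a larger letter, and larger letters must occur, necessarily in `u`.
-- So the trailing `zero` is the only one not at the front.
trailing-zeros : ∀ u j → Good (suc k) (suc (suc n)) (u ++ replicate (suc j) zero) →
                 j ≡ 0 × ∃[ t ] u ≡ gathered k t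
trailing-zeros {k} {n} u j g with shape u (Av-⊆ (++⁺ʳ _ ⊆-refl) (avoids g))
-- The isolated `zero` of `u` and a trailing one form a 211 with `suc x`.
... | is-scattered l x t v = contradiction
  (++⁺ (++⁺ˡ (replicate l zero) (refl ∷ ++⁺ˡ (map suc t) (refl ∷ minimum _)))
       (refl ∷ minimum (replicate j zero)))
  (avoids g (s≤s z≤n) (inj₁ refl))
-- The whole word would consist of zeros, but the letter `suc zero` has positive multiplicity.
... | is-gathered l [] = contradiction (trans (sym (counts g (suc zero))) no-ones) λ ()
  where
  no-ones : occ (suc zero) (gathered {suc n} l [] ++ replicate (suc j) zero) ≡ 0
  no-ones = begin
    occ (suc zero) (gathered l [] ++ replicate (suc j) zero)
      ≡⟨ occ-++ (suc zero) (gathered l []) _ ⟩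
    occ (suc zero) (gathered {suc n} l []) + occ (suc zero) (replicate (suc j) zero)
      ≡⟨ cong₂ _+_ (occ-suc-gathered zero l [])
           (trans (cong (occ (suc zero)) (sym (++-identityʳ (replicate (suc j) zero))))
             (occ-suc-gathered zero (suc j) [])) ⟩
    0 ∎
    where open ≡-Reasoning
-- Two trailing zeros form a 211 with `suc x`.
trailing-zeros {k} {n} u (suc j) g | is-gathered l (x ∷ t) = contradiction
  (++⁺ (++⁺ˡ (replicate l zero) (refl ∷ minimum (map suc t))) (refl ∷ refl ∷ minimum (replicate j zero)))
  (avoids g (s≤s z≤n) (inj₁ refl))
trailing-zeros {k} {n} u zero g | is-gathered l t@(_ ∷ _) = refl , t , cong (λ l → gathered l t) l≡k
  where
  l≡k : l ≡ k
  l≡k = ℕ-suc-injective (begin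
    suc l                                    ≡⟨ sym (+-comm l 1) ⟩
    l + 1                                    ≡⟨ cong (_+ 1) (sym (occ-zero-gathered l t)) ⟩
    occ zero (gathered l t) + 1              ≡⟨ sym (occ-++ zero (gathered l t) _) ⟩
    occ zero (gathered l t ++ [ zero ])      ≡⟨ counts g zero ⟩
    suc k                                    ∎)
    where open ≡-Reasoning

-- Lets the lemmas on scattered words relate the goodness of 2^(m-1) t 2 to that of t.
gathered-∷ʳ : ∀ k (t : List (Fin n)) → gathered k t ++ [ zero ] ≡ scattered k t []
gathered-∷ʳ k t = ++-assoc (replicate k zero) (map suc t) [ zero ]

-- With m = 2 + k, the names `end` and `penultimate` tell where the last 1 stands: in 1^(m-1) u 1
-- and in 1^(m-1) 2^(m-1) t 1 2.
Enumeration-recurrence : ∀ {k n c₂ c₁} → Enumeration (2 + k) (2 + n) c₂ → Enumeration (2 + k) (1 + n) c₁ →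
                         Enumeration (2 + k) (3 + n) (2 * c₂ + c₁)
Enumeration-recurrence {k} {n} {c₂} {c₁} E₂ E₁ = record
  { list     = candidates
  ; unique   = unique
  ; sound    = sound
  ; complete = complete
  ; total    = total
  }
  where
  m′ = suc k

  end : List (Fin (2 + n)) → List (Fin (3 + n))
  end u = scattered m′ u []

  penultimate : List (Fin (1 + n)) → List (Fin (3 + n))
  penultimate t = scattered m′ (gathered m′ t) [ zero ]

  module E₂ = Enumeration E₂
  module E₁ = Enumeration E₁

  starts       = map (gathered (suc m′)) E₂.list
  ends         = map end E₂.list
  penultimates = map penultimate E₁.list
  candidates   = starts ++ ends ++ penultimates

  unique : Unique candidates
  unique = Unique.++⁺ (Unique.map⁺ (gathered-injective (suc m′)) E₂.unique)
    (Unique.++⁺ (Unique.map⁺ (λ eq → proj₁ (scattered-injective m′ _ _ eq)) E₂.unique)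
      (Unique.map⁺ (λ eq → gathered-injective m′ (proj₁ (scattered-injective m′ _ _ eq))) E₁.unique)
      λ (p , q) → disjoint₂ (∈-map⁻ end p) (∈-map⁻ penultimate q))
    λ (p , q) → disjoint₁ (∈-map⁻ (gathered (suc m′)) p) (∈-++⁻ ends q)
    where
    disjoint₂ : ∀ {w} → ∃[ u ] u ∈ E₂.list × w ≡ end u → ∃[ t ] t ∈ E₁.list × w ≡ penultimate t → ⊥
    disjoint₂ (u , _ , refl) (t , _ , eq) with () ← proj₂ (scattered-injective m′ u (gathered m′ t) eq)

    disjoint₁ : ∀ {w} → ∃[ u ] u ∈ E₂.list × w ≡ gathered (suc m′) u →
                w ∈ ends ⊎ w ∈ penultimates → ⊥
    disjoint₁ (u , _ , refl) (inj₁ q) with ∈-map⁻ end q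
    -- `end []` consists of zeros only and is itself gathered, so emptiness is excluded by goodness
    -- instead.
    ... | []    , u∈ , eq = Good-nonempty (E₂.sound u∈)
    ... | x ∷ v , _  , eq = gathered≢scattered m′ x v [] eq
    disjoint₁ (u , _ , refl) (inj₂ q) with ∈-map⁻ penultimate q
    -- Since `m′` is `suc k`, the block `gathered m′ t` is nonempty with head `zero`.
    ... | t , _ , eq = gathered≢scattered m′ zero (gathered k t) [ zero ] eq

  complete : ∀ {w} → Good (2 + k) (3 + n) w → w ∈ candidates
  complete g with goodShape g
  ... | is-gathered u g′ = ∈-++⁺ˡ (∈-map⁺ _ (E₂.complete g′))
  ... | is-scattered x u [] _ g′ = ∈-++⁺ʳ starts (∈-++⁺ˡ (∈-map⁺ end (E₂.complete
    (subst (Good (2 + k) (2 + n)) (++-identityʳ (x ∷ u)) g′))))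
  ... | is-scattered x u (y ∷ v) v≼u g′
    -- The first letter of u is the least one, and no letter of v exceeds it, so v consists of zeros
    -- and `trailing-zeros` applies to u v.
    with refl ← head-zero g′
    with eq ← zero-word (y ∷ v) (λ x∈ → toℕ-injective (n≤0⇒n≡0 (v≼u x∈ (here refl))))
    with l≡0 , t , u≡ ← trailing-zeros (zero ∷ u) (length v)
           (subst (λ v → Good (2 + k) (2 + n) (zero ∷ u ++ v)) eq g′) =
    subst (_∈ candidates) (sym (cong₂ (scattered m′) u≡ v≡)) (∈-++⁺ʳ starts (∈-++⁺ʳ ends
      (∈-map⁺ penultimate (E₁.complete good-t))))
    where
    v≡ : y ∷ v ≡ [ zero ]
    v≡ = trans eq (cong (λ l → replicate (suc l) zero) l≡0)
    good-t : Good (2 + k) (1 + n) t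
    good-t = subst (Good (2 + k) (1 + n)) (++-identityʳ t) (proj₂ (Good-scattered⁻ t []
      (subst (Good (2 + k) (2 + n)) (trans (cong₂ _++_ u≡ v≡) (gathered-∷ʳ m′ t)) g′)))

  sound : ∀ {w} → w ∈ candidates → Good (2 + k) (3 + n) w
  sound w∈ with ∈-++⁻ starts w∈
  ... | inj₁ p with u , u∈ , refl ← ∈-map⁻ _ p = Good-gathered⁺ (E₂.sound u∈)
  ... | inj₂ p with ∈-++⁻ ends p
  ... | inj₁ q with u , u∈ , refl ← ∈-map⁻ end q = Good-scattered⁺ u [] (λ ())
    (subst (Good (2 + k) (2 + n)) (sym (++-identityʳ u)) (E₂.sound u∈))
  ... | inj₂ q with t , t∈ , refl ← ∈-map⁻ penultimate q = Good-scattered⁺ (gathered m′ t) [ zero ]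
    (λ { (here refl) _ → z≤n })
    (subst (Good (2 + k) (2 + n)) (sym (gathered-∷ʳ m′ t)) (Good-scattered⁺ t [] (λ ())
      (subst (Good (2 + k) (1 + n)) (sym (++-identityʳ t)) (E₁.sound t∈))))

  total : length candidates ≡ 2 * c₂ + c₁
  total = begin
    length candidates
      ≡⟨ length-++ starts ⟩
    length starts + length (ends ++ penultimates)
      ≡⟨ cong₂ _+_ (trans (length-map _ E₂.list) E₂.total)
           (trans (length-++ ends) (cong₂ _+_ (trans (length-map end E₂.list) E₂.total)
             (trans (length-map penultimate E₁.list) E₁.total))) ⟩
    c₂ + (c₂ + c₁)
      ≡⟨ sym (+-assoc c₂ c₂ c₁) ⟩
    c₂ + c₂ + c₁
      ≡⟨ cong (λ c → c₂ + c + c₁) (sym (+-identityʳ c₂)) ⟩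
    2 * c₂ + c₁ ∎
    where open ≡-Reasoning

theorem5 : ∀ (m : ℕ) → 2 ≤ m →
    (s 1 m 211-213 ≡ 1) ×
    (s 2 m 211-213 ≡ m + 1) ×
    (∀ (n : ℕ) → 3 ≤ n →
    s n m 211-213 ≡ 2 * s (n ∸ 1) m 211-213 + s (n ∸ 2) m 211-213)
theorem5 m@(suc (suc k)) (s≤s (s≤s z≤n)) =
    Enumeration-unique (s-Enumeration m 1) (Enumeration-one m)
  , Enumeration-unique (s-Enumeration m 2) (Enumeration-two (suc k))
  -- With `3 + n` letters, the subtractions `∸ 1` and `∸ 2` compute to `2 + n` and `1 + n`.
  , λ { (suc (suc (suc n))) (s≤s (s≤s (s≤s z≤n))) →
        Enumeration-unique (s-Enumeration m (3 + n))
          (Enumeration-recurrence (s-Enumeration m (2 + n)) (s-Enumeration m (1 + n))) }
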